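{- Let $n$ be a positive integer. The map $f:\mathrm{NN}(A_{n-1})\to\mathrm{NC}(A_{n-1})$ defined recursively in the context coincides with the L-map (the map from nonnesting partitions of $[n]$ to noncrossing partitions of $[n]$ that locally converts each crossing to a nesting); that is, $f(\alpha)=L(\alpha)$ for every $\alpha\in\mathrm{NN}(A_{n-1})$.
   Context: **Roots.** Let $e_1,\dots,e_n$ be the standard basis of $\mathbb{R}^n$. The positive roots of type $A_{n-1}$ are $\Phi^+=\{e_i-e_j:1\le j<i\le n\}$, with simple roots $r_i=e_{i+1}-e_i$ ($1\le i\le n-1$); they are the sums $r_i+\cdots+r_j$ with $1\le i\le j\le n-1$, and such a root is identified with the transposition $(i\; j+1)\in\mathfrak{S}_n$. Its support is $\{r_i,\dots,r_j\}$, its first index is $i$ and its last index is $j$. Products of permutations are composed from right to left, and a permutation in $\mathfrak{S}_n$ is identified with the partition of $[n]=\{1,\dots,n\}$ into its cycles (fixed points being singleton blocks). **$\mathrm{NN}$ and $\mathrm{NC}$.** The root order on $\Phi^+$ is $\alpha\le\beta$ iff $\beta-\alpha$ is a nonnegative integer combination of simple roots. $\mathrm{NN}(A_{n-1})$ is the set of antichains of $(\Phi^+,\le)$. An antichain is identified with the partition of $[n]$ generated by putting $i$ and $j$ in the same block whenever $e_i-e_j$ is in the antichain; this identifies $\mathrm{NN}(A_{n-1})$ with the set of nonnesting partitions of $[n]$ (if $a<b<c<d$ and $a,d$ are consecutive elements of a block, then $b,c$ are not both in some other block). $\mathrm{NC}(A_{n-1})$ is the set of noncrossing partitions of $[n]$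 (no $a<b<c<d$ with $a,c$ in one block and $b,d$ in another). **The map $f$.** For positive roots $\alpha,\beta$ with intersecting supports, $\alpha\cup\beta$ and $\alpha\cap\beta$ denote the positive roots whose supports are the union and the intersection of the supports. Antichains are written as tuples $(\alpha_1,\dots,\alpha_m)$ ordered by strictly increasing last index. An antichain is connected if any two adjacent roots $\alpha_i,\alpha_{i+1}$ have intersecting supports; its connected components are its maximal connected runs of consecutive roots. Define $f$ recursively: $f$ of the empty antichain is the identity; $f(\alpha_1)=\alpha_1$ for a single root; for a connected antichain with $m\ge2$, $$f(\alpha_1,\dots,\alpha_m)=\left(\bigcup_{k=1}^m\alpha_k\right)f(\overline\alpha_2,\dots,\overline\alpha_m),\qquad \overline\alpha_k=\alpha_{k-1}\cap\alpha_k$$ (the sequence $(\overline\alpha_2,\dots,\overline\alpha_m)$ is again an antichain, not necessarily connected); for a general antichain, $f$ is the product of the values of $f$ on its connected components, in order. **The L-map.** Represent a partition of $[n]$ by arcs: an arc joins $i<j$ whenever $i,j$ are in the same block and no element strictly between them is in that block. Given a nonnesting partition, repeatedly choose two crossing arcs joining $a,c$ and $b,d$ with $a<b<c<d$ and replace them by the nested arcs joining $a,d$ and $b,c$, until no two arcs cross. The outcome does not depend on the choices and is the arc diagram of a noncrossing partition of $[n]$, which is the image $L(\alpha)$ of the given nonnesting partition $\alpha$. -}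

module Defs where

open import Algebra.Construct.NaturalChoice.Max as Max using ()
open import Algebra.Construct.NaturalChoice.Min as Min using ()
import Algebra.Properties.CommutativeMonoid.Sum as Sum
open import Data.Bool.Base using (if_then_else_)
open import Data.Fin.Base using (Fin; suc; toℕ; inject₁; _≤_; _<_)
open import Data.Fin.Permutation as Perm
  using (Permutation′; transpose; _⟨$⟩ʳ_; _∘ₚ_)
open import Data.Fin.Properties
  using (_≟_; ≤-totalOrder; ≤-trans; any?; _≤?_; pigeonhole)
open import Data.Integer.Base as ℤ using (ℤ; 0ℤ; 1ℤ; +_)
open import Data.Integer.Properties using (+-0-commutativeMonoid)
open import Data.List.Base using (List; []; _∷_; foldl; foldr; map; length)
open import Data.List.Properties using (map-cong-local)
open import Data.List.Relation.Unary.All as All using (All; []; _∷_)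
open import Data.List.Relation.Unary.AllPairs using (AllPairs)
open import Data.List.Relation.Unary.Any using (Any)
open import Data.List.Relation.Unary.Linked using (Linked; []; [-]; _∷_)
open import Data.Nat.Base as ℕ using (ℕ; zero; suc)
import Data.Nat.Properties as ℕ
open import Data.Product.Base using (∃; _×_; _,_)
open import Data.Sum.Base using (_⊎_)
open import Function.Bundles using (Injection)
open import Function.Properties.Inverse using (↔⇒↣)
import Function.Endo.Propositional as Endo
open import Level using (0ℓ)
open import Relation.Binary.Construct.Closure.Equivalence as EqC using (EqClosure)
open import Relation.Binary.Construct.Closure.ReflexiveTransitive using (Star)
open import Relation.Binary.Core using (Rel; _⇔_)
open import Relation.Binary.PropositionalEquality
  using (_≡_; _≢_; refl; sym; trans; cong; subst; module ≡-Reasoning)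
open import Relation.Binary.Structures using (IsEquivalence)
open import Relation.Nullary.Decidable using (Dec; yes; no; does; _×-dec_)
open import Relation.Nullary.Negation using (¬_)

private
  variable
    n r : ℕ

-- Throughout, r is the rank: type A_r with r = n - 1, so [n] is Fin (suc r)
-- and n ranges over the positive integers.  Everything is 0-based: simple
-- roots are indexed by Fin r, and the simple root k is e_{k+1} - e_k.

------------------------------------------------------------------------
-- Partitions of [n]

record Partition (n : ℕ) : Set₁ where
  field
    _~_           : Rel (Fin n) 0ℓ
    isEquivalence : IsEquivalence _~_

SameBlock : Partition n → Rel (Fin n) 0ℓ
SameBlock = Partition._~_

infix 4 _≈_

_≈_ : Partition n → Partition n → Set
π ≈ ρ = SameBlock π ⇔ SameBlock ρ

Arc : Partition n → Rel (Fin n) 0ℓ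
Arc π i j = i < j × i ~ j × (∀ k → i < k → k < j → ¬ (i ~ k))
  where open Partition π

NonNesting : Partition n → Set
NonNesting π = ∀ {a b c d} → a < b → b < c → c < d →
               Arc π a d → ¬ (b ~ c × ¬ (a ~ b))
  where open Partition π

NonCrossing : Partition n → Set
NonCrossing π = ∀ {a b c d} → a < b → b < c → c < d →
                ¬ (a ~ c × b ~ d × ¬ (a ~ b))
  where open Partition π

------------------------------------------------------------------------
-- Positive roots

-- The root r_i + ⋯ + r_j, with i = first and j = last; its support is the
-- interval [first , last] of simple roots.
record Root (r : ℕ) : Set where
  constructor root
  field
    first last : Fin r
    first≤last : first ≤ last

open Root public

-- r_i + ⋯ + r_j = e_{j+1} - e_i, and the corresponding transposition is
-- (i  j+1).
lo hi : Root r → Fin (suc r)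
lo α = inject₁ (first α)
hi α = suc (last α)

transposition : Root r → Permutation′ (suc r)
transposition α = transpose (lo α) (hi α)

-- Roots and simple roots have integer coordinates, so ℤⁿ replaces ℝⁿ.
e : Fin n → Fin n → ℤ
e i x = if does (i ≟ x) then 1ℤ else 0ℤ

vec : Root r → Fin (suc r) → ℤ
vec α x = e (hi α) x ℤ.- e (lo α) x

simple : Fin r → Fin (suc r) → ℤ
simple k x = e (suc k) x ℤ.- e (inject₁ k) x

open Sum +-0-commutativeMonoid using (sum)

infix 4 _≤ᵣ_

_≤ᵣ_ : Root r → Root r → Set
_≤ᵣ_ {r} α β = ∃ λ (c : Fin r → ℕ) →
  ∀ x → vec β x ℤ.- vec α x ≡ sum (λ k → + c k ℤ.* simple k x)

------------------------------------------------------------------------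
-- Antichains, as tuples ordered by strictly increasing last index

record NN (r : ℕ) : Set where
  field
    roots     : List (Root r)
    sorted    : AllPairs (λ α β → last α < last β) roots
    antichain : AllPairs (λ α β → ¬ (α ≤ᵣ β) × ¬ (β ≤ᵣ α)) roots

open NN public using (roots)

partition : NN r → Partition (suc r)
partition α = record
  { _~_           = EqClosure generator
  ; isEquivalence = EqC.isEquivalence generator
  }
  where
  generator : Rel (Fin _) 0ℓ
  generator i j = Any (λ β → i ≡ lo β × j ≡ hi β) (roots α)

------------------------------------------------------------------------
-- Unions and intersections of roots

infix 4 _∈supp_ _⌢_

_∈supp_ : Fin r → Root r → Set
k ∈supp α = first α ≤ k × k ≤ last α

_⌢_ : Root r → Root r → Set
α ⌢ β = ∃ λ k → k ∈supp α × k ∈supp β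

_⌢?_ : (α β : Root r) → Dec (α ⌢ β)
α ⌢? β = any? λ k → (first α ≤? k ×-dec k ≤? last α)
                     ×-dec (first β ≤? k ×-dec k ≤? last β)

module _ {r : ℕ} where
  open Max (≤-totalOrder r) using (_⊔_; x≤x⊔y; ⊔-lub)
  open Min (≤-totalOrder r) using (_⊓_; x⊓y≤x; ⊓-glb)

  infixr 6 _∪_

  -- The support is the union of the two supports whenever α ⌢ β, the only
  -- case in which f uses this operation.
  _∪_ : Root r → Root r → Root r
  α ∪ β = root (first α ⊓ first β) (last α ⊔ last β)
    (≤-trans (x⊓y≤x (first α) (first β))
      (≤-trans (first≤last α) (x≤x⊔y (last α) (last β))))

  meet : (α β : Root r) → α ⌢ β → Root r
  meet α β (k , (i≤k , k≤j) , (i′≤k , k≤j′)) =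
    root (first α ⊔ first β) (last α ⊓ last β)
      (≤-trans (⊔-lub i≤k i′≤k) (⊓-glb k≤j k≤j′))

------------------------------------------------------------------------
-- Connected components

record Connected (r : ℕ) : Set where
  constructor connected
  field
    α₁     : Root r
    αs     : List (Root r)
    linked : Linked _⌢_ (α₁ ∷ αs)

elements : Connected r → List (Root r)
elements (connected α₁ αs _) = α₁ ∷ αs

attach : Root r → List (Connected r) → List (Connected r)
attach α []                          = connected α [] [-] ∷ []
attach α (C@(connected β βs l) ∷ Cs) with α ⌢? β
... | yes α⌢β = connected α (β ∷ βs) (α⌢β ∷ l) ∷ Cs
... | no  _   = connected α [] [-] ∷ C ∷ Cs

components : List (Root r) → List (Connected r)
components = foldr attach []

-- (α₁ , … , αₘ) ↦ (α₁ ∩ α₂ , … , αₘ₋₁ ∩ αₘ)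
overlaps : {αs : List (Root r)} → Linked _⌢_ αs → List (Root r)
overlaps []                 = []
overlaps [-]                = []
overlaps (_∷_ {α} {β} p ps) = meet α β p ∷ overlaps ps

⋃ : Connected r → Root r
⋃ (connected α₁ αs _) = foldl _∪_ α₁ αs

------------------------------------------------------------------------
-- The map f

infixr 9 _·_

-- Right-to-left composition; _∘ₚ_ applies its left argument first.
_·_ : Permutation′ n → Permutation′ n → Permutation′ n
σ · τ = τ ∘ₚ σ

product : List (Permutation′ n) → Permutation′ n
product = foldr _·_ Perm.id

f-connected : (List (Root r) → Permutation′ (suc r)) →
              Connected r → Permutation′ (suc r)
f-connected f (connected α [] _)          = transposition α
f-connected f C@(connected _ (_ ∷ _) l)   = transposition (⋃ C) · f (overlaps l)

-- The first argument bounds the recursion depth.  Passing to the overlaps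
-- shortens a component by one, so the length of the list is enough; see
-- f-unfold.
f-bounded : ℕ → List (Root r) → Permutation′ (suc r)
f-bounded zero    _  = Perm.id
f-bounded (suc k) αs = product (map (f-connected (f-bounded k)) (components αs))

f-list : List (Root r) → Permutation′ (suc r)
f-list αs = f-bounded (length αs) αs

f : NN r → Permutation′ (suc r)
f α = f-list (roots α)

private
  length-overlaps : ∀ {α} {αs : List (Root r)} (l : Linked _⌢_ (α ∷ αs)) →
                    length (overlaps l) ≡ length αs
  length-overlaps [-]     = refl
  length-overlaps (_ ∷ l) = cong suc (length-overlaps l)

  components-length : (αs : List (Root r)) →
    All (λ C → length (elements C) ℕ.≤ length αs) (components αs)
  components-length []       = []
  components-length (α ∷ αs) with components αs | components-length αs
  ... | []                       | []     = ℕ.s≤s ℕ.z≤n ∷ []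
  ... | connected β βs l ∷ Cs | p ∷ ps with α ⌢? β
  ...   | yes _ = ℕ.s≤s p ∷ All.map ℕ.m≤n⇒m≤1+n ps
  ...   | no  _ = ℕ.s≤s ℕ.z≤n ∷ ℕ.m≤n⇒m≤1+n p ∷ All.map ℕ.m≤n⇒m≤1+n ps

  f-connected-cong : ∀ {f g : List (Root r) → Permutation′ (suc r)} {k} →
    (∀ αs → length αs ℕ.≤ k → f αs ≡ g αs) →
    ∀ C → length (elements C) ℕ.≤ suc k → f-connected f C ≡ f-connected g C
  f-connected-cong f≡g (connected α [] _)         _ = refl
  f-connected-cong f≡g C@(connected _ (_ ∷ _) l) (ℕ.s≤s p) =
    cong (transposition (⋃ C) ·_)
      (f≡g (overlaps l) (subst (ℕ._≤ _) (sym (length-overlaps l)) p))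

  f-bounded-irrelevant : ∀ j k m (αs : List (Root r)) → length αs ℕ.≤ m →
    m ℕ.≤ j → m ℕ.≤ k → f-bounded j αs ≡ f-bounded k αs
  f-bounded-irrelevant zero    zero    _ _  _ _ _ = refl
  f-bounded-irrelevant zero    (suc k) _ [] _ _ _ = refl
  f-bounded-irrelevant (suc j) zero    _ [] _ _ _ = refl
  f-bounded-irrelevant zero    (suc _) zero (_ ∷ _) () _ _
  f-bounded-irrelevant (suc _) zero    zero (_ ∷ _) () _ _
  f-bounded-irrelevant (suc j) (suc k) zero [] _ _ _ = refl
  f-bounded-irrelevant (suc j) (suc k) (suc m) αs p (ℕ.s≤s q) (ℕ.s≤s q′) =
    cong product (map-cong-local (All.map
      (λ {C} b → f-connected-cong {k = m}
        (λ βs s → f-bounded-irrelevant j k m βs s q q′) C (ℕ.≤-trans b p))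
      (components-length αs)))

f-unfold : (αs : List (Root r)) →
           f-list αs ≡ product (map (f-connected f-list) (components αs))
f-unfold []           = refl
f-unfold αs@(_ ∷ αs′) =
  cong product (map-cong-local (All.map
    (λ {C} b → f-connected-cong {k = length αs′}
      (λ βs s → f-bounded-irrelevant (length αs′) (length βs) (length βs)
                  βs ℕ.≤-refl s ℕ.≤-refl) C b)
    (components-length αs)))

------------------------------------------------------------------------
-- The partition of [n] into the cycles of a permutation

module _ {n : ℕ} (σ : Permutation′ n) where
  open Endo (Fin n) using (_^_; ^-homo)

  private
    s : Fin n → Fin n
    s = σ ⟨$⟩ʳ_

  SameCycle : Rel (Fin n) 0ℓ
  SameCycle i j = ∃ λ k → (s ^ k) i ≡ j

  private
    ^-+ : ∀ k l i → (s ^ (k ℕ.+ l)) i ≡ (s ^ k) ((s ^ l) i)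
    ^-+ k l i = cong (λ g → g i) (^-homo s k l)

    ^-injective : ∀ k {i j} → (s ^ k) i ≡ (s ^ k) j → i ≡ j
    ^-injective zero    eq = eq
    ^-injective (suc k) eq = ^-injective k (Injection.injective (↔⇒↣ σ) eq)

    cycle-trans : ∀ {i j k} → SameCycle i j → SameCycle j k → SameCycle i k
    cycle-trans {i} (a , p) (b , q) =
      b ℕ.+ a , trans (^-+ b a i) (trans (cong (s ^ b) p) q)

    cycle-back : ∀ i → SameCycle (s i) i
    cycle-back i with pigeonhole (ℕ.n<1+n n) (λ k → (s ^ toℕ k) i)
    ... | a , b , a<b , eq with ℕ.m≤n⇒∃[o]m+o≡n a<b
    ...   | d , 1+a+d≡b = d , sym (^-injective (toℕ a) (begin
      (s ^ toℕ a) i                   ≡⟨ eq ⟩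
      (s ^ toℕ b) i                   ≡⟨ cong (λ t → (s ^ t) i) b≡ ⟩
      (s ^ (toℕ a ℕ.+ (d ℕ.+ 1))) i   ≡⟨ ^-+ (toℕ a) (d ℕ.+ 1) i ⟩
      (s ^ toℕ a) ((s ^ (d ℕ.+ 1)) i) ≡⟨ cong (s ^ toℕ a) (^-+ d 1 i) ⟩
      (s ^ toℕ a) ((s ^ d) (s i))     ∎))
      where
      open ≡-Reasoning
      b≡ : toℕ b ≡ toℕ a ℕ.+ (d ℕ.+ 1)
      b≡ = trans (sym 1+a+d≡b)
             (trans (sym (ℕ.+-suc (toℕ a) d))
                    (cong (toℕ a ℕ.+_) (sym (ℕ.+-comm d 1))))

    cycle-sym : ∀ {i j} → SameCycle i j → SameCycle j i
    cycle-sym (zero  , refl) = 0 , refl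
    cycle-sym (suc k , refl) =
      cycle-trans (cycle-back _) (cycle-sym (k , refl))

  cycles : Partition n
  cycles = record
    { _~_           = SameCycle
    ; isEquivalence = record
      { refl = 0 , refl ; sym = cycle-sym ; trans = cycle-trans }
    }

------------------------------------------------------------------------
-- The L-map

Diagram : ℕ → Set₁
Diagram n = Rel (Fin n) 0ℓ

record Crossing (D : Diagram n) (a b c d : Fin n) : Set where
  field
    a<b : a < b
    b<c : b < c
    c<d : c < d
    ac  : D a c
    bd  : D b d

nest : Diagram n → (a b c d : Fin n) → Diagram n
nest D a b c d i j =
  (D i j × (i , j) ≢ (a , c) × (i , j) ≢ (b , d))
  ⊎ (i , j) ≡ (a , d)
  ⊎ (i , j) ≡ (b , c)

infix 4 _⟶_ _↦ᴸ_

data _⟶_ (D D′ : Diagram n) : Set where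
  uncross : ∀ {a b c d} → Crossing D a b c d → D′ ⇔ nest D a b c d → D ⟶ D′

-- The graph of L: ρ ↦ᴸ π says that some sequence of choices leads from the
-- nonnesting partition ρ to the noncrossing partition π.
record _↦ᴸ_ (ρ π : Partition n) : Set₁ where
  field
    nonNesting  : NonNesting ρ
    nonCrossing : NonCrossing π
    outcome     : Diagram n
    run         : Star _⟶_ (Arc ρ) outcome
    finished    : ∀ {a b c d} → ¬ Crossing outcome a b c d
    arcs        : outcome ⇔ Arc π

{-# OPTIONS --safe #-}

-- Uncrossing two arcs preserves the set of left ends and the set of right ends,
-- and a noncrossing matching is determined by these two sets; so every run of
-- the L-map from a given diagram has the same outcome, and it suffices to
-- exhibit one run ending in the arcs of f α.  For a connected antichain, uncrossing
-- neighbours from right to left produces the union of all roots followed by the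
-- overlaps, which is the recursion of f.  The arcs so obtained, in the order of
-- their left ends, are the transpositions whose product is f α; since each
-- later arc is nested in or to the right of the earlier ones, this product maps
-- the left end of every arc to its right end, so its cycles are the blocks.

module Submission where

open import Defs
open import Data.Nat.Base using (ℕ; suc)
open import Function.Bundles using (_⇔_)

open import Algebra.Construct.NaturalChoice.Max as Max using ()
open import Algebra.Construct.NaturalChoice.Min as Min using ()
import Algebra.Properties.CommutativeMonoid.Sum as Sum
open import Data.Fin.Base using (Fin; zero; suc; toℕ; inject₁; _≤_; _<_; _>_)
open import Data.Fin.Induction using (<-wellFounded; >-wellFounded)
open import Data.Fin.Permutation as Perm using (Permutation′; transpose; _⟨$⟩ʳ_)
open import Data.Fin.Properties
  using (_≟_; <-cmp; <⇒≢; ≤-antisym; ≤-totalOrder; any?; toℕ-inject₁; inject₁-injective;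
         suc-injective; ≤̄⇒inject₁<)
open import Data.Integer.Base as ℤ using (ℤ; +_)
import Data.Integer.Properties as ℤ
open import Data.Integer.Tactic.RingSolver using (solve-∀)
open import Data.List.Base using (List; []; _∷_; _++_; foldl; map; concat; length)
open import Data.List.Membership.Propositional using (_∈_; find)
open import Data.List.Properties using (length-++)
open import Data.List.Relation.Unary.All as All using (All; []; _∷_)
import Data.List.Relation.Unary.All.Properties as All
open import Data.List.Relation.Unary.AllPairs as AllPairs using (AllPairs; []; _∷_)
import Data.List.Relation.Unary.AllPairs.Properties as AllPairs
open import Data.List.Relation.Unary.Any as Any using (Any; here; there)
import Data.List.Relation.Unary.Any.Properties as Any
open import Data.List.Relation.Unary.Linked using (Linked; []; [-]; _∷_)
open import Data.Nat.Base as ℕ using (zero; _∸_; z≤n; s≤s)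
import Data.Nat.Properties as ℕ
open import Data.Nat.Properties
  using (<-trans; <-irrefl; <⇒≤; ≤-refl; ≤-trans; ≤-<-trans; <-≤-trans; ≰⇒>)
open import Data.Product.Base as Product using (∃; ∃₂; _×_; _,_; proj₁; proj₂)
open import Data.Sum.Base as Sum⊎ using (_⊎_; inj₁; inj₂)
open import Function.Base using (_∘_; id)
open import Function.Bundles using (mk⇔)
open import Induction.WellFounded using (Acc; acc)
open import Level using (0ℓ)
open import Relation.Binary.Construct.Closure.Equivalence as EqC using (EqClosure)
open import Relation.Binary.Construct.Closure.ReflexiveTransitive as Star
  using (Star; ε; _◅_; _◅◅_)
open import Relation.Binary.Construct.Closure.Symmetric using (fwd; bwd)
open import Relation.Binary.Core using (Rel; _⇒_) renaming (_⇔_ to _⇔ᵣ_)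
open import Relation.Binary.Definitions using (Decidable; tri<; tri≈; tri>)
open import Relation.Binary.PropositionalEquality
  using (_≡_; _≢_; refl; sym; trans; cong; cong₂; subst; subst₂; module ≡-Reasoning)
open import Relation.Binary.Structures using (IsEquivalence)
open import Relation.Nullary.Decidable using (Dec; yes; no; _×-dec_; dec-true; dec-false)
open import Relation.Nullary.Negation using (¬_; contradiction)

private
  variable
    n r : ℕ

-- Diagrams and partitions

record Matching (D : Diagram n) : Set where
  field
    ascending    : ∀ {i j} → D i j → i < j
    functional   : ∀ {i j k} → D i j → D i k → j ≡ k
    cofunctional : ∀ {i j k} → D i k → D j k → i ≡ j

open Matching

Planar : Diagram n → Set
Planar D = ∀ {a b c d} → ¬ Crossing D a b c d

generated : Diagram n → Partition n
generated D = record
  { _~_ = EqClosure D ; isEquivalence = EqC.isEquivalence D }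

⇔-sym : {D E : Diagram n} → D ⇔ᵣ E → E ⇔ᵣ D
⇔-sym (p , q) = q , p

⇔-trans : {D E F : Diagram n} → D ⇔ᵣ E → E ⇔ᵣ F → D ⇔ᵣ F
⇔-trans (p , q) (p′ , q′) = p′ ∘ p , q ∘ q′

path⇒≤ : {D : Diagram n} → Matching D → Star D ⇒ _≤_
path⇒≤ M ε        = ≤-refl
path⇒≤ M (d ◅ ds) = ≤-trans (<⇒≤ (ascending M d)) (path⇒≤ M ds)

path⇒≈ : {D : Diagram n} → Star D ⇒ EqClosure D
path⇒≈ = Star.map fwd

unsnoc : {D : Diagram n} → ∀ {i k} → Star D i k →
         i ≡ k ⊎ ∃ λ j → Star D i j × D j k
unsnoc ε        = inj₁ refl
unsnoc (d ◅ ds) with unsnoc ds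
... | inj₁ refl         = inj₂ (_ , ε , d)
... | inj₂ (_ , ds′ , e) = inj₂ (_ , d ◅ ds′ , e)

-- Components of a matching are chains: where a zigzag turns, two arcs share a left or a right end,
-- so `functional` or `cofunctional` identifies them and they cancel.
linear : {D : Diagram n} → Matching D → ∀ {i j} → EqClosure D i j →
         Star D i j ⊎ Star D j i
linear M ε = inj₁ ε
linear M (fwd d ◅ ds) with linear M ds
... | inj₁ up = inj₁ (d ◅ up)
... | inj₂ down with unsnoc down
...   | inj₁ refl            = inj₁ (d ◅ ε)
...   | inj₂ (_ , down′ , e) with cofunctional M d e
...     | refl = inj₂ down′
linear M (bwd d ◅ ds) with linear M ds
... | inj₂ down             = inj₂ (down ◅◅ d ◅ ε)
... | inj₁ ε                = inj₂ (d ◅ ε)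
... | inj₁ (e ◅ up) with functional M d e
...   | refl = inj₁ up

linear-< : {D : Diagram n} → Matching D → ∀ {i j} → i < j → EqClosure D i j →
           Star D i j
linear-< M i<j i~j with linear M i~j
... | inj₁ up   = up
... | inj₂ down = contradiction (≤-<-trans (path⇒≤ M down) i<j) (<-irrefl refl)

-- The first arc of an ascending path from `i` is the only arc leaving `i`, so nothing in the block
-- lies between its two ends.
arc-generated : {D : Diagram n} → Matching D → Arc (generated D) ⇔ᵣ D
arc-generated {D = D} M = to , from
  where
  to : Arc (generated D) ⇒ D
  to (i<j , i~j , gap) with linear-< M i<j i~j
  ... | ε = contradiction i<j (<-irrefl refl)
  ... | d ◅ ε = d
  ... | d ◅ e ◅ ds = contradiction (fwd d ◅ ε)
    (gap _ (ascending M d) (<-≤-trans (ascending M e) (path⇒≤ M ds)))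

  from : D ⇒ Arc (generated D)
  from {i} {j} d = ascending M d , fwd d ◅ ε , gap
    where
    gap : ∀ k → i < k → k < j → ¬ EqClosure D i k
    gap k i<k k<j i~k with linear-< M i<k i~k
    ... | ε = <-irrefl refl i<k
    ... | e ◅ ds with functional M d e
    ...   | refl = <-irrefl refl (≤-<-trans (path⇒≤ M ds) k<j)

≈⇒Arc⇔ : {π ρ : Partition n} → π ≈ ρ → Arc π ⇔ᵣ Arc ρ
≈⇒Arc⇔ (to , from) =
  (λ (i<j , i~j , gap) → i<j , to i~j , λ k p q → gap k p q ∘ from) ,
  (λ (i<j , i~j , gap) → i<j , from i~j , λ k p q → gap k p q ∘ to)

-- No decidability of the blocks of π is needed: an element without an outgoing
-- arc is related to nothing larger, by induction on the larger element.
arcs-determine : (π : Partition n) {D : Diagram n} → Decidable D →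
                 Arc π ⇔ᵣ D → π ≈ generated D
arcs-determine {n} π {D} D? (to , from) = blocks , EqC.fold isEquivalence (proj₁ ∘ proj₂ ∘ from)
  where
  open Partition π
  open IsEquivalence isEquivalence renaming (refl to ~-refl; sym to ~-sym; trans to ~-trans)

  isolated : ∀ {i} → (∀ k → ¬ D i k) → ∀ k → Acc _<_ k → i < k → ¬ (i ~ k)
  isolated none k (acc rec) i<k i~k =
    none k (to (i<k , i~k , λ j i<j j<k → isolated none j (rec j<k) i<j))

  up : ∀ {i j} → Acc _>_ i → i < j → i ~ j → Star D i j
  up {i} {j} (acc rec) i<j i~j with any? (D? i)
  ... | no none = contradiction i~j (isolated (λ k d → none (k , d)) j (<-wellFounded j) i<j)
  ... | yes (k , d) with from d
  ...   | i<k , i~k , gap with <-cmp k j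
  ...     | tri< k<j _ _  = d ◅ up (rec i<k) k<j (~-trans (~-sym i~k) i~j)
  ...     | tri≈ _ refl _ = d ◅ ε
  ...     | tri> _ _ j<k  = contradiction i~j (gap j i<j j<k)

  blocks : ∀ {i j} → i ~ j → EqClosure D i j
  blocks {i} {j} i~j with <-cmp i j
  ... | tri< i<j _ _  = path⇒≈ (up (>-wellFounded i) i<j i~j)
  ... | tri≈ _ refl _ = ε
  ... | tri> _ _ j<i  =
    EqC.symmetric D (path⇒≈ (up (>-wellFounded j) j<i (~-sym i~j)))

-- Passes from blocks to single arcs: a path that does not stop at `j` has to leap over it, and
-- leaping arcs are what crossings are made of.
visit-or-jump : {D : Diagram n} → ∀ {i j k} → Star D i k → i ≤ j → j ≤ k →
                Star D i j ⊎ ∃₂ λ x y → Star D i x × D x y × Star D y k × x < j × j < y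
visit-or-jump {j = j} ε i≤j j≤i with ≤-antisym i≤j j≤i
... | refl = inj₁ ε
visit-or-jump {i = i} {j = j} (_◅_ {j = m} d ds) i≤j j≤k with <-cmp m j
... | tri> _ _ j<m with <-cmp i j
...   | tri< i<j _ _  = inj₂ (_ , _ , ε , d , ds , i<j , j<m)
...   | tri≈ _ refl _ = inj₁ ε
...   | tri> _ _ j<i  = contradiction (≤-<-trans i≤j j<i) (<-irrefl refl)
visit-or-jump (d ◅ ds) i≤j j≤k | tri≈ _ refl _ = inj₁ (d ◅ ε)
visit-or-jump (d ◅ ds) i≤j j≤k | tri< m<j _ _ with visit-or-jump ds (<⇒≤ m<j) j≤k
... | inj₁ p = inj₁ (d ◅ p)
... | inj₂ (x , y , p , e , q , x<j , j<y) = inj₂ (x , y , d ◅ p , e , q , x<j , j<y)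

generated-nonCrossing : {D : Diagram n} → Matching D → Planar D →
                        NonCrossing (generated D)
generated-nonCrossing {D = D} M planar a<b b<c c<d (a~c , b~d , a≁b)
  with visit-or-jump (linear-< M (<-trans a<b b<c) a~c) (<⇒≤ a<b) (<⇒≤ b<c)
... | inj₁ a⋯b = a≁b (path⇒≈ a⋯b)
... | inj₂ (x , y , a⋯x , xy , y⋯c , x<b , b<y)
  with visit-or-jump (linear-< M (<-trans b<c c<d) b~d) (<⇒≤ b<y)
         (≤-trans (path⇒≤ M y⋯c) (<⇒≤ c<d))
...   | inj₁ b⋯y = a≁b (path⇒≈ (a⋯x ◅◅ xy ◅ ε) ◅◅ EqC.symmetric D (path⇒≈ b⋯y))
-- Since `x < b ≤ u < y < v`, the arcs from `x` to `y` and from `u` to `v` cross.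
...   | inj₂ (u , v , b⋯u , uv , _ , u<y , y<v) = planar record
  { a<b = <-≤-trans x<b (path⇒≤ M b⋯u) ; b<c = u<y ; c<d = y<v ; ac = xy ; bd = uv }

generated-nonNesting : {D : Diagram n} → Matching D →
  (∀ {a b c d} → D a d → D b c → a < b → ¬ (c < d)) → NonNesting (generated D)
generated-nonNesting M unnested a<b b<c c<d ad (b~c , _)
  with linear-< M b<c b~c
... | ε      = <-irrefl refl b<c
-- The first arc of the path from `b` to `c` already lies strictly inside the arc from `a` to `d`.
... | e ◅ es =
  unnested (proj₁ (arc-generated M) ad) e a<b (≤-<-trans (path⇒≤ M es) c<d)

nonCrossing-resp-≈ : {π ρ : Partition n} → π ≈ ρ → NonCrossing π → NonCrossing ρ
nonCrossing-resp-≈ (to , from) nc a<b b<c c<d (a~c , b~d , a≁b) =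
  nc a<b b<c c<d (from a~c , from b~d , a≁b ∘ to)

-- Left and right ends as invariants of uncrossing.

Opener Closer : Diagram n → Fin n → Set
Opener D i = ∃ λ j → D i j
Closer D j = ∃ λ i → D i j

record SameEnds (D E : Diagram n) : Set where
  field
    opener : ∀ {i} → Opener D i → Opener E i
    opener⁻ : ∀ {i} → Opener E i → Opener D i
    closer : ∀ {i} → Closer D i → Closer E i
    closer⁻ : ∀ {i} → Closer E i → Closer D i

open SameEnds

sameEnds-refl : {D : Diagram n} → SameEnds D D
sameEnds-refl = record { opener = id ; opener⁻ = id ; closer = id ; closer⁻ = id }

sameEnds-sym : {D E : Diagram n} → SameEnds D E → SameEnds E D
sameEnds-sym S = record
  { opener = opener⁻ S ; opener⁻ = opener S ; closer = closer⁻ S ; closer⁻ = closer S }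

sameEnds-trans : {D E F : Diagram n} → SameEnds D E → SameEnds E F → SameEnds D F
sameEnds-trans S T = record
  { opener = opener T ∘ opener S ; opener⁻ = opener⁻ S ∘ opener⁻ T
  ; closer = closer T ∘ closer S ; closer⁻ = closer⁻ S ∘ closer⁻ T }

-- Induction on the length of the arc i–j: if E lacks it, then the E-arcs
-- at i and j are either shorter, hence in D as well, or cross each other.
planar-unique : {D E : Diagram n} → Matching D → Matching E →
  Planar D → Planar E → SameEnds D E → D ⇒ E
planar-unique {n} M N P Q S {i} {j} = go (suc (toℕ j ∸ toℕ i)) M N P Q S ℕ.≤-refl
  where
  go : ∀ m {D E : Diagram n} → Matching D → Matching E → Planar D → Planar E →
       SameEnds D E → ∀ {i j} → toℕ j ∸ toℕ i ℕ.< m → D i j → E i j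
  go (suc m) M N P Q S {i} {j} (s≤s bound) ij with opener S (_ , ij) | closer S (_ , ij)
  ... | j′ , ij′ | i′ , i′j with <-cmp j′ j
  ...   | tri≈ _ refl _ = ij′
  ...   | tri< j′<j _ _ = contradiction (functional M ij
    (go m N M Q P (sameEnds-sym S)
      (ℕ.<-≤-trans (ℕ.∸-monoˡ-< j′<j (<⇒≤ (ascending N ij′))) bound) ij′))
    (<⇒≢ j′<j ∘ sym)
  ...   | tri> _ _ j<j′ with <-cmp i′ i
  ...     | tri≈ _ refl _ = i′j
  ...     | tri< i′<i _ _ = contradiction
    (record { a<b = i′<i ; b<c = ascending M ij ; c<d = j<j′ ; ac = i′j ; bd = ij′ }) Q
  ...     | tri> _ _ i<i′ = contradiction (cofunctional M ij
    (go m N M Q P (sameEnds-sym S)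
      (ℕ.<-≤-trans (ℕ.∸-monoʳ-< i<i′ (<⇒≤ (ascending N i′j))) bound) i′j))
    (<⇒≢ i<i′)

-- Removing the crossing arcs frees exactly the ends that the nested arcs take up, so no surviving
-- arc competes with a new one.
nest-matching : {D : Diagram n} → Matching D → ∀ {a b c d} → Crossing D a b c d →
                Matching (nest D a b c d)
nest-matching {n} {D} M {a} {b} {c} {d} X = record
  { ascending = asc ; functional = fun ; cofunctional = cofun }
  where
  open Crossing X
  D′ = nest D a b c d

  a≢b : a ≢ b
  a≢b = <⇒≢ a<b

  c≢d : c ≢ d
  c≢d = <⇒≢ c<d

  asc : ∀ {i j} → D′ i j → i < j
  asc (inj₁ (ij , _))     = ascending M ij
  asc (inj₂ (inj₁ refl)) = <-trans a<b (<-trans b<c c<d)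
  asc (inj₂ (inj₂ refl)) = b<c

  from-a : ∀ {j} → D a j → ¬ ((a , j) ≢ (a , c))
  from-a aj a,j≢a,c = a,j≢a,c (cong (a ,_) (functional M aj ac))

  from-b : ∀ {j} → D b j → ¬ ((b , j) ≢ (b , d))
  from-b bj b,j≢b,d = b,j≢b,d (cong (b ,_) (functional M bj bd))

  to-c : ∀ {i} → D i c → ¬ ((i , c) ≢ (a , c))
  to-c ic i,c≢a,c = i,c≢a,c (cong (_, c) (cofunctional M ic ac))

  to-d : ∀ {i} → D i d → ¬ ((i , d) ≢ (b , d))
  to-d id i,d≢b,d = i,d≢b,d (cong (_, d) (cofunctional M id bd))

  fun : ∀ {i j k} → D′ i j → D′ i k → j ≡ k
  fun (inj₁ (ij , _))        (inj₁ (ik , _))        = functional M ij ik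
  fun (inj₁ (aj , ≢ac , _))  (inj₂ (inj₁ refl))     = contradiction ≢ac (from-a aj)
  fun (inj₁ (bj , _ , ≢bd))  (inj₂ (inj₂ refl))     = contradiction ≢bd (from-b bj)
  fun (inj₂ (inj₁ refl))     (inj₁ (ak , ≢ac , _))  = contradiction ≢ac (from-a ak)
  fun (inj₂ (inj₂ refl))     (inj₁ (bk , _ , ≢bd))  = contradiction ≢bd (from-b bk)
  fun (inj₂ (inj₁ refl))     (inj₂ (inj₁ refl))     = refl
  fun (inj₂ (inj₂ refl))     (inj₂ (inj₂ refl))     = refl
  fun (inj₂ (inj₁ refl))     (inj₂ (inj₂ eq))       = contradiction (cong proj₁ eq) a≢b
  fun (inj₂ (inj₂ refl))     (inj₂ (inj₁ eq))       = contradiction (sym (cong proj₁ eq)) a≢b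

  cofun : ∀ {i j k} → D′ i k → D′ j k → i ≡ j
  cofun (inj₁ (ik , _))        (inj₁ (jk , _))        = cofunctional M ik jk
  cofun (inj₁ (id , _ , ≢bd))  (inj₂ (inj₁ refl))     = contradiction ≢bd (to-d id)
  cofun (inj₁ (ic , ≢ac , _))  (inj₂ (inj₂ refl))     = contradiction ≢ac (to-c ic)
  cofun (inj₂ (inj₁ refl))     (inj₁ (jd , _ , ≢bd))  = contradiction ≢bd (to-d jd)
  cofun (inj₂ (inj₂ refl))     (inj₁ (jc , ≢ac , _))  = contradiction ≢ac (to-c jc)
  cofun (inj₂ (inj₁ refl))     (inj₂ (inj₁ refl))     = refl
  cofun (inj₂ (inj₂ refl))     (inj₂ (inj₂ refl))     = refl
  cofun (inj₂ (inj₁ refl))     (inj₂ (inj₂ eq))       = contradiction (sym (cong proj₂ eq)) c≢d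
  cofun (inj₂ (inj₂ refl))     (inj₂ (inj₁ eq))       = contradiction (cong proj₂ eq) c≢d

nest-sameEnds : {D : Diagram n} → ∀ {a b c d} → Crossing D a b c d →
                SameEnds D (nest D a b c d)
nest-sameEnds {n} {D} {a} {b} {c} {d} X = record
  { opener  = op
  ; opener⁻ = λ { (_ , inj₁ (ij , _))     → _ , ij
               ; (_ , inj₂ (inj₁ refl)) → _ , ac
               ; (_ , inj₂ (inj₂ refl)) → _ , bd }
  ; closer  = cl
  ; closer⁻ = λ { (_ , inj₁ (ij , _))     → _ , ij
               ; (_ , inj₂ (inj₁ refl)) → _ , bd
               ; (_ , inj₂ (inj₂ refl)) → _ , ac }
  }
  where
  open Crossing X

  op : ∀ {i} → Opener D i → Opener (nest D a b c d) i
  op {i} (j , ij) with i ≟ a | i ≟ b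
  ... | yes refl | _        = d , inj₂ (inj₁ refl)
  ... | no _     | yes refl = c , inj₂ (inj₂ refl)
  ... | no i≢a   | no i≢b   = j , inj₁ (ij , i≢a ∘ cong proj₁ , i≢b ∘ cong proj₁)

  cl : ∀ {j} → Closer D j → Closer (nest D a b c d) j
  cl {j} (i , ij) with j ≟ c | j ≟ d
  ... | yes refl | _        = b , inj₂ (inj₂ refl)
  ... | no _     | yes refl = a , inj₂ (inj₁ refl)
  ... | no j≢c   | no j≢d   = i , inj₁ (ij , j≢c ∘ cong proj₂ , j≢d ∘ cong proj₂)

⇔-matching : {D E : Diagram n} → D ⇔ᵣ E → Matching D → Matching E
⇔-matching (_ , from) M = record
  { ascending    = λ x → ascending M (from x)
  ; functional   = λ x y → functional M (from x) (from y)
  ; cofunctional = λ x y → cofunctional M (from x) (from y) }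

⇔-sameEnds : {D E : Diagram n} → D ⇔ᵣ E → SameEnds D E
⇔-sameEnds (to , from) = record
  { opener = λ (j , x) → j , to x ; opener⁻ = λ (j , x) → j , from x
  ; closer = λ (j , x) → j , to x ; closer⁻ = λ (j , x) → j , from x }

⇔-planar : {D E : Diagram n} → D ⇔ᵣ E → Planar D → Planar E
⇔-planar (_ , from) P X = P record
  { a<b = a<b ; b<c = b<c ; c<d = c<d ; ac = from ac ; bd = from bd }
  where open Crossing X

run-invariant : {D E : Diagram n} → Star _⟶_ D E → Matching D →
                Matching E × SameEnds D E
run-invariant ε M = M , sameEnds-refl
run-invariant (uncross X D′⇔ ◅ run) M
  with run-invariant run (⇔-matching (⇔-sym D′⇔) (nest-matching M X))
... | N , S = N , sameEnds-trans (sameEnds-trans (nest-sameEnds X) (⇔-sameEnds (⇔-sym D′⇔))) S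

-- Moves a run between equivalent starting diagrams, such as `diagram (roots α)` and
-- `Arc (partition α)`. A step fixes its target only up to equivalence, so the first step absorbs
-- the change; an empty run ends in `E` itself.
run-respˡ : {D E F : Diagram n} → D ⇔ᵣ E → Star _⟶_ D F →
            ∃ λ G → Star _⟶_ E G × F ⇔ᵣ G
run-respˡ D⇔E ε = _ , ε , D⇔E
run-respˡ {n} {D} {E} (to , from) (uncross {a} {b} {c} {d} X D′⇔ ◅ run) =
  _ , uncross X′ (⇔-trans D′⇔ nest⇔) ◅ run , id , id
  where
  open Crossing X
  X′ : Crossing E a b c d
  X′ = record { a<b = a<b ; b<c = b<c ; c<d = c<d ; ac = to ac ; bd = to bd }

  nest⇔ : nest D a b c d ⇔ᵣ nest E a b c d
  nest⇔ = Sum⊎.map₁ (λ (x , y) → to x , y) , Sum⊎.map₁ (λ (x , y) → from x , y)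

-- Roots and their diagrams

-- Written exactly as the generator in `partition`, so that `partition α` is
-- `generated (diagram (roots α))` by definition.
diagram : List (Root r) → Diagram (suc r)
diagram αs i j = Any (λ β → i ≡ lo β × j ≡ hi β) αs

diagram? : (αs : List (Root r)) → Decidable (diagram αs)
diagram? αs i j = Any.any? (λ β → (i ≟ lo β) ×-dec (j ≟ hi β)) αs

root-≡ : {α β : Root r} → first α ≡ first β → last α ≡ last β → α ≡ β
root-≡ {α = root i j p} {root .i .j q} refl refl = cong (root i j) (ℕ.≤-irrelevant p q)

lo<hi⇒≤ : {i j : Fin r} → inject₁ i < suc j → i ≤ j
lo<hi⇒≤ {i = i} (s≤s p) = subst (ℕ._≤ _) (toℕ-inject₁ i) p

lo-mono-< : {i j : Fin r} → i < j → inject₁ i < inject₁ j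
lo-mono-< {i = i} {j} = subst₂ ℕ._<_ (sym (toℕ-inject₁ i)) (sym (toℕ-inject₁ j))

lo<hi : (α : Root r) → lo α < hi α
lo<hi α = ≤̄⇒inject₁< (first≤last α)

infix 4 _≺_ _◁_

_≺_ : Rel (Root r) 0ℓ
α ≺ β = first α < first β × last α < last β

-- Noncrossing arcs in the order of left ends: the later one lies to the right or is nested. Since
-- `hi` is one past `last`, the first case still allows `hi α ≡ lo β`, two consecutive arcs of a
-- block.
_◁_ : Rel (Root r) 0ℓ
α ◁ β = first α < first β × (last α < first β ⊎ last β < last α)

FirstSorted : List (Root r) → Set
FirstSorted = AllPairs (λ α β → first α < first β)

pairwise : {A : Set} {R : Rel A 0ℓ} {xs : List A} → AllPairs R xs → ∀ {x y} →
           x ∈ xs → y ∈ xs → x ≡ y ⊎ R x y ⊎ R y x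
pairwise (p ∷ ps) (here refl) (here refl) = inj₁ refl
pairwise (p ∷ ps) (here refl) (there y∈)  = inj₂ (inj₁ (All.lookup p y∈))
pairwise (p ∷ ps) (there x∈)  (here refl) = inj₂ (inj₂ (All.lookup p x∈))
pairwise (p ∷ ps) (there x∈)  (there y∈)  = pairwise ps x∈ y∈

≺-matching : {αs : List (Root r)} → AllPairs _≺_ αs → Matching (diagram αs)
≺-matching {αs = αs} inc = record { ascending = asc ; functional = fun ; cofunctional = cofun }
  where
  asc : ∀ {i j} → diagram αs i j → i < j
  asc ij with find ij
  ... | β , _ , refl , refl = lo<hi β

  fun : ∀ {i j k} → diagram αs i j → diagram αs i k → j ≡ k
  fun ij ik with find ij | find ik
  ... | β , β∈ , refl , refl | γ , γ∈ , eq , refl with pairwise inc β∈ γ∈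
  ...   | inj₁ refl             = refl
  ...   | inj₂ (inj₁ (β<γ , _)) = contradiction (inject₁-injective eq) (<⇒≢ β<γ)
  ...   | inj₂ (inj₂ (γ<β , _)) = contradiction (sym (inject₁-injective eq)) (<⇒≢ γ<β)

  cofun : ∀ {i j k} → diagram αs i k → diagram αs j k → i ≡ j
  cofun ik jk with find ik | find jk
  ... | β , β∈ , refl , refl | γ , γ∈ , refl , eq with pairwise inc β∈ γ∈
  ...   | inj₁ refl             = refl
  ...   | inj₂ (inj₁ (_ , β<γ)) = contradiction (suc-injective eq) (<⇒≢ β<γ)
  ...   | inj₂ (inj₂ (_ , γ<β)) = contradiction (sym (suc-injective eq)) (<⇒≢ γ<β)

≺-unnested : {αs : List (Root r)} → AllPairs _≺_ αs → ∀ {a b c d} →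
             diagram αs a d → diagram αs b c → a < b → ¬ (c < d)
≺-unnested inc ad bc a<b c<d with find ad | find bc
... | β , β∈ , refl , refl | γ , γ∈ , refl , refl with pairwise inc β∈ γ∈
...   | inj₁ refl             = <-irrefl refl a<b
...   | inj₂ (inj₁ (_ , β<γ)) = <-irrefl refl (<-trans (s≤s β<γ) c<d)
...   | inj₂ (inj₂ (γ<β , _)) = <-irrefl refl (<-trans a<b (lo-mono-< γ<β))

◁-planar : {αs : List (Root r)} → AllPairs _◁_ αs → Planar (diagram αs)
◁-planar nested X with find ac | find bd
  where open Crossing X
... | β , β∈ , refl , refl | γ , γ∈ , refl , refl with pairwise nested β∈ γ∈
...   | inj₁ refl = <-irrefl refl (Crossing.a<b X)
...   | inj₂ (inj₁ (_ , inj₁ β<γ)) = <-irrefl refl (<-≤-trans β<γ (lo<hi⇒≤ (Crossing.b<c X)))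
...   | inj₂ (inj₁ (_ , inj₂ γ<β)) = <-irrefl refl (<-trans (s≤s γ<β) (Crossing.c<d X))
...   | inj₂ (inj₂ (γ<β , _)) = <-irrefl refl (<-trans (lo-mono-< γ<β) (Crossing.a<b X))

-- Uncrossing sorted lists of roots

infix 4 _⇝_ _⇝*_

-- Only adjacent roots are uncrossed, so a list sorted by first index stays sorted.
-- The results are specified by their indices because the proof components of
-- meet and _∪_ would get in the way.
data _⇝_ {r : ℕ} : Rel (List (Root r)) 0ℓ where
  swap : ∀ {α β α′ β′ γs} → first α < first β → first β ≤ last α → last α < last β →
         first α′ ≡ first α → last α′ ≡ last β → first β′ ≡ first β → last β′ ≡ last α →
         α ∷ β ∷ γs ⇝ α′ ∷ β′ ∷ γs
  skip : ∀ {α βs βs′} → βs ⇝ βs′ → α ∷ βs ⇝ α ∷ βs′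

_⇝*_ : Rel (List (Root r)) 0ℓ
_⇝*_ = Star _⇝_

⇝-++ : {αs βs : List (Root r)} → ∀ γs → αs ⇝ βs → αs ++ γs ⇝ βs ++ γs
⇝-++ γs (swap p q s e₁ e₂ e₃ e₄) = swap p q s e₁ e₂ e₃ e₄
⇝-++ γs (skip x)                 = skip (⇝-++ γs x)

⇝*-++ : {αs βs γs δs : List (Root r)} → αs ⇝* βs → γs ⇝* δs → αs ++ γs ⇝* βs ++ δs
⇝*-++ {βs = βs} {γs} x y = Star.gmap (_++ γs) (⇝-++ γs) x ◅◅ prefix βs y
  where
  prefix : ∀ αs {γs δs} → γs ⇝* δs → αs ++ γs ⇝* αs ++ δs
  prefix []       y = y
  prefix (α ∷ αs) y = Star.gmap (α ∷_) skip (prefix αs y)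

module _ (P : Fin r → Set) where

  -- A swap leaves first indices in place and exchanges two last indices, so bounds on either kind
  -- of index survive every run.
  ⇝-first : ∀ {αs βs} → αs ⇝ βs → All (P ∘ first) αs → All (P ∘ first) βs
  ⇝-first (swap _ _ _ e₁ _ e₃ _) (p ∷ q ∷ ps) = subst P (sym e₁) p ∷ subst P (sym e₃) q ∷ ps
  ⇝-first (skip x)               (p ∷ ps)     = p ∷ ⇝-first x ps

  ⇝*-first : ∀ {αs βs} → αs ⇝* βs → All (P ∘ first) αs → All (P ∘ first) βs
  ⇝*-first ε        ps = ps
  ⇝*-first (x ◅ xs) ps = ⇝*-first xs (⇝-first x ps)

  ⇝-last : ∀ {αs βs} → αs ⇝ βs → All (P ∘ last) αs → All (P ∘ last) βs
  ⇝-last (swap _ _ _ _ e₂ _ e₄) (p ∷ q ∷ ps) = subst P (sym e₂) q ∷ subst P (sym e₄) p ∷ ps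
  ⇝-last (skip x)               (p ∷ ps)     = p ∷ ⇝-last x ps

  ⇝*-last : ∀ {αs βs} → αs ⇝* βs → All (P ∘ last) αs → All (P ∘ last) βs
  ⇝*-last ε        ps = ps
  ⇝*-last (x ◅ xs) ps = ⇝*-last xs (⇝-last x ps)

⇝-sorted : {αs βs : List (Root r)} → αs ⇝ βs → FirstSorted αs → FirstSorted βs
⇝-sorted (swap {α} {β} _ _ _ e₁ _ e₃ _) ((p ∷ ps) ∷ qs ∷ sorted) rewrite sym e₁ | sym e₃ =
  (p ∷ ps) ∷ qs ∷ sorted
⇝-sorted (skip {α} x) (ps ∷ sorted) = ⇝-first (first α <_) x ps ∷ ⇝-sorted x sorted

-- Supplies the inequations in `nest`: in a list sorted by first index, arcs are told apart by their
-- left ends.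
first-absent : {α : Root r} {βs : List (Root r)} → All (λ β → first α < first β) βs →
               ∀ {i j} → diagram βs i j → i ≢ lo α
first-absent {α = α} α< ij refl with find ij
... | β , β∈ , eq , _ = <⇒≢ (All.lookup α< β∈) (inject₁-injective eq)

⇝⇒⟶ : {αs βs : List (Root r)} → αs ⇝ βs → FirstSorted αs → diagram αs ⟶ diagram βs
⇝⇒⟶ (swap {α} {β} {α′} {β′} {γs} p q s e₁ e₂ e₃ e₄) ((_ ∷ α<) ∷ β< ∷ _) =
  uncross X (to , from)
  where
  D = diagram (α ∷ β ∷ γs)

  X : Crossing D (lo α) (lo β) (hi α) (hi β)
  -- As `hi` is one past `last`, the weak bound `first β ≤ last α` gives the strict `lo β < hi α`.
  X = record { a<b = lo-mono-< p ; b<c = ≤̄⇒inject₁< q ; c<d = s≤s s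
             ; ac = here (refl , refl) ; bd = there (here (refl , refl)) }

  to : diagram (α′ ∷ β′ ∷ γs) ⇒ nest D (lo α) (lo β) (hi α) (hi β)
  to (here (refl , refl))         = inj₂ (inj₁ (cong₂ _,_ (cong inject₁ e₁) (cong suc e₂)))
  to (there (here (refl , refl))) = inj₂ (inj₂ (cong₂ _,_ (cong inject₁ e₃) (cong suc e₄)))
  to (there (there ij))           = inj₁ (there (there ij) ,
    first-absent {α = α} α< ij ∘ cong proj₁ , first-absent {α = β} β< ij ∘ cong proj₁)

  from : nest D (lo α) (lo β) (hi α) (hi β) ⇒ diagram (α′ ∷ β′ ∷ γs)
  from (inj₁ (here (refl , refl) , ≢ , _))         = contradiction refl ≢
  from (inj₁ (there (here (refl , refl)) , _ , ≢)) = contradiction refl ≢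
  from (inj₁ (there (there ij) , _))               = there (there ij)
  from (inj₂ (inj₁ refl)) = here (cong inject₁ (sym e₁) , cong suc (sym e₂))
  from (inj₂ (inj₂ refl)) = there (here (cong inject₁ (sym e₃) , cong suc (sym e₄)))
⇝⇒⟶ (skip {α} {βs} {βs′} x) (α< ∷ sorted) with ⇝⇒⟶ x sorted
... | uncross {a} {b} {c} {d} X (to , from) = uncross
  record { a<b = a<b ; b<c = b<c ; c<d = c<d ; ac = there ac ; bd = there bd } (to′ , from′)
  where
  open Crossing X

  to′ : diagram (α ∷ βs′) ⇒ nest (diagram (α ∷ βs)) a b c d
  -- The head arc is neither of the two being uncrossed, because its left end precedes theirs.
  to′ (here (refl , refl)) = inj₁ (here (refl , refl) ,
    first-absent {α = α} α< ac ∘ sym ∘ cong proj₁ , first-absent {α = α} α< bd ∘ sym ∘ cong proj₁)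
  to′ (there ij) = Sum⊎.map₁ (λ (x , y) → there x , y) (to ij)

  from′ : nest (diagram (α ∷ βs)) a b c d ⇒ diagram (α ∷ βs′)
  from′ (inj₁ (here ij , _))  = here ij
  from′ (inj₁ (there ij , y)) = there (from (inj₁ (ij , y)))
  from′ (inj₂ x)              = there (from (inj₂ x))

⇝*⇒⟶ : {αs βs : List (Root r)} → αs ⇝* βs → FirstSorted αs → Star _⟶_ (diagram αs) (diagram βs)
⇝*⇒⟶ ε        _      = ε
⇝*⇒⟶ (x ◅ xs) sorted = ⇝⇒⟶ x sorted ◅ ⇝*⇒⟶ xs (⇝-sorted x sorted)

-- Products of transpositions

transpose-first : (i j : Fin n) → transpose i j ⟨$⟩ʳ i ≡ j
transpose-first i j rewrite dec-true (i ≟ i) refl = refl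

transpose-second : (i j : Fin n) → transpose i j ⟨$⟩ʳ j ≡ i
transpose-second i j with j ≟ i
... | yes refl = refl
... | no _ rewrite dec-true (j ≟ j) refl = refl

transpose-other : (i j : Fin n) {k : Fin n} → k ≢ i → k ≢ j → transpose i j ⟨$⟩ʳ k ≡ k
transpose-other i j {k} k≢i k≢j rewrite dec-false (k ≟ i) k≢i | dec-false (k ≟ j) k≢j = refl

_∉ends_ : Fin (suc r) → List (Root r) → Set
i ∉ends αs = All (λ β → i ≢ lo β × i ≢ hi β) αs

-- Enough about `σ` to know its cycles: `lifts` puts blocks inside cycles and `within` puts cycles
-- inside blocks. The images of right ends are left open; `fixes` is what makes the description pass
-- to products.
record Realises (σ : Permutation′ (suc r)) (αs : List (Root r)) : Set where
  field
    lifts  : All (λ β → σ ⟨$⟩ʳ lo β ≡ hi β) αs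
    fixes  : ∀ {i} → i ∉ends αs → σ ⟨$⟩ʳ i ≡ i
    within : ∀ i → EqClosure (diagram αs) i (σ ⟨$⟩ʳ i)

open Realises

realises-id : Realises {r} Perm.id []
realises-id = record { lifts = [] ; fixes = λ _ → refl ; within = λ _ → ε }

realises-transposition : (α : Root r) → Realises (transposition α) (α ∷ [])
realises-transposition α = record
  { lifts  = transpose-first (lo α) (hi α) ∷ []
  ; fixes  = λ { ((≢lo , ≢hi) ∷ []) → transpose-other (lo α) (hi α) ≢lo ≢hi }
  ; within = λ i → within′ (i ≟ lo α) (i ≟ hi α) }
  where
  R = EqClosure (diagram (α ∷ []))

  within′ : ∀ {i} → Dec (i ≡ lo α) → Dec (i ≡ hi α) → R i (transposition α ⟨$⟩ʳ i)
  within′ (yes refl) _          = subst (R _) (sym (transpose-first (lo α) (hi α)))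
                                    (fwd (here (refl , refl)) ◅ ε)
  within′ (no _)     (yes refl) = subst (R _) (sym (transpose-second (lo α) (hi α)))
                                    (bwd (here (refl , refl)) ◅ ε)
  within′ (no ≢lo)   (no ≢hi)   =
    subst (R _) (sym (transpose-other (lo α) (hi α) ≢lo ≢hi)) ε

-- The left end of the earlier arc avoids the later arc, and the right end of the later arc avoids
-- the earlier one. `lo γ` and `hi β` are not compared, since they may coincide.
◁-ends : (β γ : Root r) → β ◁ γ →
         (lo β ≢ lo γ × lo β ≢ hi γ) × (hi γ ≢ lo β × hi γ ≢ hi β)
◁-ends β γ (β<γ , apart) =
  (<⇒≢ (lo-mono-< β<γ) , <⇒≢ lo<hi′) , (<⇒≢ lo<hi′ ∘ sym , ends apart)
  where
  lo<hi′ : lo β < hi γ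
  lo<hi′ = <-trans (lo-mono-< β<γ) (lo<hi γ)

  ends : last β < first γ ⊎ last γ < last β → hi γ ≢ hi β
  ends (inj₁ β<γ′) eq = <⇒≢ (<-≤-trans β<γ′ (first≤last γ)) (sym (suc-injective eq))
  ends (inj₂ γ<β)  eq = <⇒≢ γ<β (suc-injective eq)

-- `τ` acts first. It fixes the left ends in `αs`, which `σ` then lifts; it lifts those in `βs` to
-- right ends that `σ` fixes.
realises-· : {σ τ : Permutation′ (suc r)} {αs βs : List (Root r)} →
             All (λ α → All (α ◁_) βs) αs →
             Realises σ αs → Realises τ βs → Realises (σ · τ) (αs ++ βs)
realises-· {σ = σ} {τ} {αs} {βs} sep R S = record
  { lifts  = All.++⁺
      (All.zipWith (λ {α} (α◁ , eq) → trans (cong (σ ⟨$⟩ʳ_)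
        (fixes S (All.map (λ {β} → proj₁ ∘ ◁-ends α β) α◁))) eq)
        (sep , lifts R))
      (All.zipWith (λ {β} (◁β , eq) → trans (cong (σ ⟨$⟩ʳ_) eq)
        (fixes R (All.map (λ {α} → proj₂ ∘ ◁-ends α β) ◁β)))
        (All.All-swap sep , lifts S))
  ; fixes  = λ i∉ → trans (cong (σ ⟨$⟩ʳ_) (fixes S (All.++⁻ʳ αs i∉))) (fixes R (All.++⁻ˡ αs i∉))
  ; within = λ i → EqC.map (Any.++⁺ʳ αs) (within S i) ◅◅ EqC.map Any.++⁺ˡ (within R _)
  }

realises⇒cycles : {σ : Permutation′ (suc r)} {αs : List (Root r)} → Realises σ αs →
                  cycles σ ≈ generated (diagram αs)
realises⇒cycles {σ = σ} {αs} R = to , EqC.fold (Partition.isEquivalence (cycles σ)) step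
  where
  to : ∀ {i j} → SameCycle σ i j → EqClosure (diagram αs) i j
  to (zero  , refl) = ε
  to (suc k , refl) = to (k , refl) ◅◅ within R _

  step : ∀ {i j} → diagram αs i j → SameCycle σ i j
  step ij with find ij
  ... | β , β∈ , refl , refl = 1 , All.lookup (lifts R) β∈

-- The induction statement for the recursion of `f`: one list is at once the end of a run,
-- noncrossing, and a factorisation of `σ`.
record Resolves (σ : Permutation′ (suc r)) (αs : List (Root r)) : Set where
  constructor resolves
  field
    resolved : List (Root r)
    run      : αs ⇝* resolved
    nested   : AllPairs _◁_ resolved
    realises : Realises σ resolved

-- Unions and overlaps of roots in increasing order.

module _ {r : ℕ} where
  open Max (≤-totalOrder r) public using (_⊔_; x≤y⇒x⊔y≈y; x≤x⊔y)
  open Min (≤-totalOrder r) public using (x≤y⇒x⊓y≈x)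

≺⇒first-∪ : (α β : Root r) → α ≺ β → first (α ∪ β) ≡ first α
≺⇒first-∪ _ _ (p , _) = x≤y⇒x⊓y≈x (<⇒≤ p)

≺⇒last-∪ : (α β : Root r) → α ≺ β → last (α ∪ β) ≡ last β
≺⇒last-∪ _ _ (_ , q) = x≤y⇒x⊔y≈y (<⇒≤ q)

≺⇒first-meet : (α β : Root r) → α ≺ β → (p : α ⌢ β) → first (meet α β p) ≡ first β
≺⇒first-meet _ _ (p , _) _ = x≤y⇒x⊔y≈y (<⇒≤ p)

≺⇒last-meet : (α β : Root r) → α ≺ β → (p : α ⌢ β) → last (meet α β p) ≡ last α
≺⇒last-meet _ _ (_ , q) _ = x≤y⇒x⊓y≈x (<⇒≤ q)

-- `⋃` folds from the left while `collapse` recurses on the tail; this lets the accumulator `α ∪ β`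
-- be replaced by `β`.
last-foldl-∪ : (α β : Root r) → last α ≡ last β → ∀ γs →
               last (foldl _∪_ α γs) ≡ last (foldl _∪_ β γs)
last-foldl-∪ _ _ eq []       = eq
last-foldl-∪ α β eq (γ ∷ γs) = last-foldl-∪ (α ∪ γ) (β ∪ γ) (cong (_⊔ last γ) eq) γs

first-foldl-∪ : {α : Root r} {βs : List (Root r)} → AllPairs _≺_ (α ∷ βs) →
                first (foldl _∪_ α βs) ≡ first α
first-foldl-∪ ([] ∷ [])                                  = refl
first-foldl-∪ {α = α} {β ∷ βs} ((α≺β ∷ α≺) ∷ β≺ ∷ inc) =
  trans (first-foldl-∪ (All.zipWith (λ {γ} → ∪-≺ γ) (α≺ , β≺) ∷ inc)) (≺⇒first-∪ α β α≺β)
  where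
  ∪-≺ : ∀ γ → α ≺ γ × β ≺ γ → (α ∪ β) ≺ γ
  ∪-≺ _ ((p , _) , (_ , q)) =
    subst (_< _) (sym (≺⇒first-∪ α β α≺β)) p , subst (_< _) (sym (≺⇒last-∪ α β α≺β)) q

last-≤-foldl-∪ : (α : Root r) (βs : List (Root r)) → last α ≤ last (foldl _∪_ α βs)
last-≤-foldl-∪ α []       = ≤-refl
last-≤-foldl-∪ α (β ∷ βs) =
  ≤-trans {toℕ (last α)} (x≤x⊔y (last α) (last β)) (last-≤-foldl-∪ (α ∪ β) βs)

last-foldl-∪-∷ : (α β : Root r) → α ≺ β → ∀ γs →
                 last (foldl _∪_ α (β ∷ γs)) ≡ last (foldl _∪_ β γs)
last-foldl-∪-∷ α β α≺β = last-foldl-∪ (α ∪ β) β (≺⇒last-∪ α β α≺β)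

-- Uncrossing from right to left keeps the crossing roots adjacent.
collapse : ∀ {α : Root r} {αs} (l : Linked _⌢_ (α ∷ αs)) → AllPairs _≺_ (α ∷ αs) →
           ∀ {β} → first β ≡ first α → last β ≡ last (foldl _∪_ α αs) →
           α ∷ αs ⇝* β ∷ overlaps l
collapse [-] _ eq eq′ = subst (λ β → _ ⇝* β ∷ []) (root-≡ (sym eq) (sym eq′)) ε
collapse {α = α} {β ∷ βs} (α⌢β@(k , (_ , k≤α) , (β≤k , _)) ∷ l) ((α≺β ∷ _) ∷ inc) eq eq′ =
  Star.gmap (α ∷_) skip (collapse l inc {foldl _∪_ β βs} β-first refl) ◅◅
  -- The union of the tail begins where `β` does, so it crosses `α`; the inner arc left by the swap
  -- has the indices of `meet α β α⌢β`.
  swap (subst (_ <_) (sym β-first) (proj₁ α≺β))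
       (subst (_≤ last α) (sym β-first) (≤-trans β≤k k≤α))
       (<-≤-trans (proj₂ α≺β) (last-≤-foldl-∪ β βs))
       eq (trans eq′ (last-foldl-∪-∷ α β α≺β βs))
       (trans (≺⇒first-meet α β α≺β α⌢β) (sym β-first)) (≺⇒last-meet α β α≺β α⌢β) ◅ ε
  where
  β-first : first (foldl _∪_ β βs) ≡ first β
  β-first = first-foldl-∪ inc

-- The upper bound nests the overlaps under the union. The lower bound on `last` keeps them
-- increasing; it is weak because the first overlap ends exactly at `last α`.
overlaps-bounds : ∀ {α : Root r} {αs} (l : Linked _⌢_ (α ∷ αs)) → AllPairs _≺_ (α ∷ αs) →
  All (λ γ → first α < first γ × last α ≤ last γ × last γ < last (foldl _∪_ α αs)) (overlaps l)
overlaps-bounds [-] _ = []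
overlaps-bounds {α = α} {β ∷ βs} (α⌢β ∷ l) ((α≺β@(p , q) ∷ _) ∷ inc) =
  ( subst (first α <_) (sym (≺⇒first-meet α β α≺β α⌢β)) p
  , subst (last α ≤_) (sym last-meet) ≤-refl
  , subst₂ _<_ (sym last-meet) (sym last-⋃) (<-≤-trans q (last-≤-foldl-∪ β βs))) ∷
  All.map (λ {γ} (x , y , z) →
      <-trans p x , ≤-trans (<⇒≤ q) y , subst (last γ <_) (sym last-⋃) z)
    (overlaps-bounds l inc)
  where
  last-meet : last (meet α β α⌢β) ≡ last α
  last-meet = ≺⇒last-meet α β α≺β α⌢β

  last-⋃ : last (foldl _∪_ α (β ∷ βs)) ≡ last (foldl _∪_ β βs)
  last-⋃ = last-foldl-∪-∷ α β α≺β βs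

-- Lets the recursion continue, with `≺` in the role of the antichain condition.
overlaps-≺ : ∀ {αs : List (Root r)} (l : Linked _⌢_ αs) → AllPairs _≺_ αs →
             AllPairs _≺_ (overlaps l)
overlaps-≺ []        _ = []
overlaps-≺ [-]       _ = []
overlaps-≺ {αs = α ∷ β ∷ _} (α⌢β ∷ l) ((α≺β@(p , q) ∷ _) ∷ inc) =
  All.map (λ (x , y , _) → subst (_< _) (sym (≺⇒first-meet α β α≺β α⌢β)) x
                         , subst (_< _) (sym (≺⇒last-meet α β α≺β α⌢β)) (<-≤-trans q y))
    (overlaps-bounds l inc) ∷ overlaps-≺ l inc

length-overlaps : ∀ {α : Root r} {αs} (l : Linked _⌢_ (α ∷ αs)) →
                  length (overlaps l) ≡ length αs
length-overlaps [-]     = refl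
length-overlaps (_ ∷ l) = cong suc (length-overlaps l)

-- Connected components

Apart : Rel (List (Root r)) 0ℓ
Apart αs βs = All (λ α → All (λ β → last α < first β) βs) αs

resolves-· : {σ τ : Permutation′ (suc r)} {αs βs : List (Root r)} → Apart αs βs →
             Resolves σ αs → Resolves τ βs → Resolves (σ · τ) (αs ++ βs)
resolves-· apart (resolves αs′ run nested real) (resolves βs′ run′ nested′ real′) =
  resolves (αs′ ++ βs′) (⇝*-++ run run′) (AllPairs.++⁺ nested nested′ sep)
    (realises-· sep real real′)
  where
  -- Each run only rearranges indices within its own side, so the gap between the sides persists.
  apart′ : Apart αs′ βs′
  apart′ = ⇝*-last (λ l → All (λ β → l < first β) βs′) run
    (All.map (λ {α} → ⇝*-first (last α <_) run′) apart)

  sep : All (λ α → All (α ◁_) βs′) αs′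
  sep = All.map (λ {α} → All.map (λ p → ≤-<-trans (first≤last α) p , inj₁ p)) apart′

resolves-product : (g : Connected r → Permutation′ (suc r)) {Cs : List (Connected r)} →
  AllPairs Apart (map elements Cs) → All (λ C → Resolves (g C) (elements C)) Cs →
  Resolves (product (map g Cs)) (concat (map elements Cs))
resolves-product g _ [] = resolves [] ε [] realises-id
resolves-product g (apart ∷ aparts) (R ∷ Rs) =
  resolves-· (All.map All.concat⁺ (All.All-swap apart)) R (resolves-product g aparts Rs)

-- `attach` tests only the nearest root `β`, and sortedness does the rest. If `α` misses `β`, it
-- ends before the least first index present; if they meet, the other components begin after
-- `last β`, which exceeds `last α`.
attach-components : (α : Root r) (Cs : List (Connected r)) →
  All (α ≺_) (concat (map elements Cs)) → FirstSorted (concat (map elements Cs)) →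
  AllPairs Apart (map elements Cs) →
  concat (map elements (attach α Cs)) ≡ α ∷ concat (map elements Cs) ×
  AllPairs Apart (map elements (attach α Cs))
attach-components α [] _ _ _ = refl , [] ∷ []
attach-components α (connected β βs l ∷ Cs) (α≺β ∷ α≺) (β< ∷ _) (apart ∷ aparts)
  with α ⌢? β
... | yes _   = refl , All.map (λ a → All.map (<-trans (proj₂ α≺β)) (All.head a) ∷ a) apart ∷ aparts
... | no ¬α⌢β = refl , All.map (_∷ []) (All.concat⁻ {xss = (β ∷ βs) ∷ map elements Cs}
                         (α<β ∷ All.map (<-trans α<β) β<)) ∷ apart ∷ aparts
  where
  α<β : last α < first β
  -- Otherwise `first β` itself would lie in both supports.
  α<β = ≰⇒> λ β≤α → ¬α⌢β (first β , (<⇒≤ (proj₁ α≺β) , β≤α) , (≤-refl , first≤last β))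

components-partition : {αs : List (Root r)} → AllPairs _≺_ αs →
  concat (map elements (components αs)) ≡ αs × AllPairs Apart (map elements (components αs))
components-partition [] = refl , []
components-partition {αs = α ∷ αs} (α≺ ∷ inc) with components-partition inc
... | eq , aparts with attach-components α (components αs)
                        (subst (All (α ≺_)) (sym eq) α≺)
                        (subst FirstSorted (sym eq) (AllPairs.map proj₁ inc)) aparts
...   | eq′ , aparts′ = trans eq′ (cong (α ∷_) eq) , aparts′

module _ {A : Set} where

  length-≤-concat : (xss : List (List A)) → All (λ xs → length xs ℕ.≤ length (concat xss)) xss
  length-≤-concat []         = []
  length-≤-concat (xs ∷ xss) rewrite length-++ xs {concat xss} =
    ℕ.m≤m+n _ _ ∷ All.map (λ p → ≤-trans p (ℕ.m≤n+m _ (length xs))) (length-≤-concat xss)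

  AllPairs-++⁻ : {R : Rel A 0ℓ} (xs : List A) {ys : List A} →
                 AllPairs R (xs ++ ys) → AllPairs R xs × AllPairs R ys
  AllPairs-++⁻ []       ps       = [] , ps
  AllPairs-++⁻ (x ∷ xs) (p ∷ ps) =
    Product.map₁ (All.++⁻ˡ xs p ∷_) (AllPairs-++⁻ xs ps)

  AllPairs-concat⁻ : {R : Rel A 0ℓ} (xss : List (List A)) →
                     AllPairs R (concat xss) → All (AllPairs R) xss
  AllPairs-concat⁻ []         _  = []
  AllPairs-concat⁻ (xs ∷ xss) ps with AllPairs-++⁻ xs ps
  ... | qs , qss = qs ∷ AllPairs-concat⁻ xss qss

-- After `collapse` the union stays in front while the overlaps are resolved behind it. Index bounds
-- survive that run, so the union still encloses the result.
resolves-connected : {g : List (Root r) → Permutation′ (suc r)} {k : ℕ} →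
  (∀ αs → length αs ℕ.≤ k → AllPairs _≺_ αs → Resolves (g αs) αs) →
  ∀ C → length (elements C) ℕ.≤ suc k → AllPairs _≺_ (elements C) →
  Resolves (f-connected g C) (elements C)
resolves-connected _ (connected α [] [-]) _ _ =
  resolves (α ∷ []) ε ([] ∷ []) (realises-transposition α)
resolves-connected rec C@(connected α αs@(_ ∷ _) l) (s≤s bound) inc
  with rec (overlaps l) (subst (ℕ._≤ _) (sym (length-overlaps l)) bound) (overlaps-≺ l inc)
... | resolves βs run nested real = resolves (⋃ C ∷ βs)
  (collapse l inc eq refl ◅◅ Star.gmap (⋃ C ∷_) skip run)
  (⋃◁ ∷ nested) (realises-· (⋃◁ ∷ []) (realises-transposition (⋃ C)) real)
  where
  eq : first (⋃ C) ≡ first α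
  eq = first-foldl-∪ inc

  ⋃◁ : All (⋃ C ◁_) βs
  ⋃◁ = All.zipWith (λ (p , q) → subst (_< _) (sym eq) p , inj₂ q)
    ( ⇝*-first (first α <_) run (All.map proj₁ (overlaps-bounds l inc))
    , ⇝*-last (_< last (⋃ C)) run (All.map (proj₂ ∘ proj₂) (overlaps-bounds l inc)))

-- Induction on the recursion depth; `f` is the case where `k` is the length of the list.
f-bounded-resolves : ∀ k (αs : List (Root r)) → length αs ℕ.≤ k → AllPairs _≺_ αs →
                     Resolves (f-bounded k αs) αs
f-bounded-resolves zero    [] _     _   = resolves [] ε [] realises-id
f-bounded-resolves (suc k) αs bound inc with components-partition inc
... | eq , aparts = subst (Resolves _) eq (resolves-product _ aparts (All.zipWith
  (λ (p , q) → resolves-connected (f-bounded-resolves k) _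
    (≤-trans p (subst (λ xs → length xs ℕ.≤ suc k) (sym eq) bound)) q)
  ( All.map⁻ (length-≤-concat (map elements (components αs)))
  , All.map⁻ (AllPairs-concat⁻ _ (subst (AllPairs _≺_) (sym eq) inc)))))

-- The root order

open Sum ℤ.+-0-commutativeMonoid using (sum; sum-cong-≗; ∑-distrib-+; sum-replicate-zero)

-- Telescoping, with `c` the indicator of the indices from `i` up to but excluding `j`. It is chosen
-- before `g` because `≤ᵣ` asks for the same coefficients in every coordinate.
increment-sum : {i j : Fin (suc r)} → i ≤ j → ∃ λ (c : Fin r → ℕ) → ∀ (g : Fin (suc r) → ℤ) →
  g j ℤ.- g i ≡ sum (λ k → + c k ℤ.* (g (suc k) ℤ.- g (inject₁ k)))
increment-sum {r} {zero} {zero} _ = (λ _ → 0) , λ g →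
  trans (ℤ.+-inverseʳ (g zero)) (sym (sum-replicate-zero r))
increment-sum {suc r} {zero} {suc j} _ with increment-sum {r} {zero} {j} z≤n
... | c , eq = (λ { zero → 1 ; (suc k) → c k }) , λ g →
  trans (split (g zero) (g (suc zero)) (g (suc j))) 
    (cong (λ s → + 1 ℤ.* (g (suc zero) ℤ.- g zero) ℤ.+ s) (eq (g ∘ suc)))
  where
  split : ∀ x y z → z ℤ.- x ≡ + 1 ℤ.* (y ℤ.- x) ℤ.+ (z ℤ.- y)
  split = solve-∀
increment-sum {suc r} {suc i} {suc j} (s≤s i≤j) with increment-sum {r} {i} {j} i≤j
... | c , eq = (λ { zero → 0 ; (suc k) → c k }) , λ g →
  trans (eq (g ∘ suc)) (sym (ℤ.+-identityˡ _))

-- The difference consists of the simple roots by which the support of `β` overhangs that of `α` on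
-- the left and on the right; each part telescopes.
⊆supp⇒≤ᵣ : {α β : Root r} → first β ≤ first α → last α ≤ last β → α ≤ᵣ β
⊆supp⇒≤ᵣ {r} {α} {β} p q
  with increment-sum (lo-mono-≤ p) | increment-sum {i = hi α} {hi β} (s≤s q)
  where
  lo-mono-≤ : first β ≤ first α → lo β ≤ lo α
  lo-mono-≤ = subst₂ ℕ._≤_ (sym (toℕ-inject₁ (first β))) (sym (toℕ-inject₁ (first α)))
... | c , eq | c′ , eq′ = (λ k → c k ℕ.+ c′ k) , λ x → begin
  (e (hi β) x ℤ.- e (lo β) x) ℤ.- (e (hi α) x ℤ.- e (lo α) x)
    ≡⟨ regroup (e (hi β) x) (e (lo β) x) (e (hi α) x) (e (lo α) x) ⟩
  (e (lo α) x ℤ.- e (lo β) x) ℤ.+ (e (hi β) x ℤ.- e (hi α) x)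
    ≡⟨ cong₂ ℤ._+_ (eq (λ i → e i x)) (eq′ (λ i → e i x)) ⟩
  sum (λ k → + c k ℤ.* simple k x) ℤ.+ sum (λ k → + c′ k ℤ.* simple k x)
    ≡⟨ ∑-distrib-+ {r} (λ k → + c k ℤ.* simple k x) (λ k → + c′ k ℤ.* simple k x) ⟨
  sum (λ k → + c k ℤ.* simple k x ℤ.+ + c′ k ℤ.* simple k x)
    ≡⟨ sum-cong-≗ (λ k → sym (ℤ.*-distribʳ-+ (simple k x) (+ c k) (+ c′ k))) ⟩
  sum (λ k → + (c k ℕ.+ c′ k) ℤ.* simple k x) ∎
  where
  open ≡-Reasoning
  regroup : ∀ a b c d → (a ℤ.- b) ℤ.- (c ℤ.- d) ≡ (d ℤ.- b) ℤ.+ (a ℤ.- c)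
  regroup = solve-∀

-- If first indices failed to increase along with the last ones, the earlier support would be
-- contained in the later, making the roots comparable.
roots-≺ : (α : NN r) → AllPairs _≺_ (roots α)
roots-≺ α = AllPairs.zipWith
  (λ {β} {γ} (last< , ≰ , _) → ≰⇒> (λ p → ≰ (⊆supp⇒≤ᵣ {α = β} {γ} p (<⇒≤ last<))) , last<)
  (NN.sorted α , NN.antichain α)

-- The cycles of `f α` and the outcome of the L-map.

theorem3p5 : (r : ℕ) (α : NN r) (π : Partition (suc r)) →
    (cycles (f α) ≈ π) ⇔ (partition α ↦ᴸ π)
theorem3p5 r α π = mk⇔ to from
  where
  inc : AllPairs _≺_ (roots α)
  inc = roots-≺ α

  open Resolves (f-bounded-resolves (length (roots α)) (roots α) ≤-refl inc)

  D E : Diagram (suc r)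
  D = diagram (roots α)
  E = diagram resolved

  D-matching : Matching D
  D-matching = ≺-matching inc

  D⇔arcs : D ⇔ᵣ Arc (partition α)
  D⇔arcs = ⇔-sym (arc-generated D-matching)

  D⟶E : Star _⟶_ D E
  D⟶E = ⇝*⇒⟶ run (AllPairs.map proj₁ inc)

  E-matching : Matching E
  E-matching = proj₁ (run-invariant D⟶E D-matching)

  cycles≈E : cycles (f α) ≈ generated E
  cycles≈E = realises⇒cycles realises

  to : cycles (f α) ≈ π → partition α ↦ᴸ π
  -- The run found for the roots ends in `E`, whose blocks are the cycles of `f α` and hence those
  -- of `π`.
  to cycles≈π with run-respˡ D⇔arcs D⟶E
  ... | G , run′ , E⇔G = record
    { nonNesting  = generated-nonNesting D-matching (≺-unnested inc)
    ; nonCrossing = nonCrossing-resp-≈ {π = generated E} {π} E≈π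
                      (generated-nonCrossing E-matching (◁-planar nested))
    ; outcome     = G
    ; run         = run′
    ; finished    = ⇔-planar E⇔G (◁-planar nested)
    ; arcs        = ⇔-trans (⇔-sym E⇔G)
        (⇔-trans (⇔-sym (arc-generated E-matching)) (≈⇒Arc⇔ {π = generated E} {π} E≈π)) }
    where
    E≈π : generated E ≈ π
    E≈π = ⇔-trans (⇔-sym cycles≈E) cycles≈π

  from : partition α ↦ᴸ π → cycles (f α) ≈ π
  -- Any finished run ends in a planar matching with the ends of `E`. Applied both ways,
  -- `planar-unique` identifies it with `E`, and `arcs-determine` carries this over to the blocks of
  -- `π`.
  from L = ⇔-trans cycles≈E (⇔-sym (arcs-determine π (diagram? resolved)
    (⇔-trans (⇔-sym L.arcs) (planar-unique matching E-matching L.finished planar ends ,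
      planar-unique E-matching matching planar L.finished (sameEnds-sym ends)))))
    where
    module L = _↦ᴸ_ L

    planar : Planar E
    planar = ◁-planar nested

    outcome-invariant : Matching L.outcome × SameEnds (Arc (partition α)) L.outcome
    outcome-invariant = run-invariant L.run (⇔-matching D⇔arcs D-matching)

    matching : Matching L.outcome
    matching = proj₁ outcome-invariant

    ends : SameEnds L.outcome E
    ends = sameEnds-trans (sameEnds-sym (proj₂ outcome-invariant))
      (sameEnds-trans (sameEnds-sym (⇔-sameEnds D⇔arcs)) (proj₂ (run-invariant D⟶E D-matching)))
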